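{- A distributive lattice $\mathbf L=\langle L,\sqcap,\sqcup,1\rangle$ (with top element $1$) is a classical implicative lattice if and only if it is a dual disjunctive lattice and for all $a,b\in L$ such that $b\in[a,1]$ there exists $b^*=\min\{x\in[a,1]: b\sqcup x=1\}$.
   Context: A classical implicative lattice is a relatively complemented distributive lattice with maximum $1$ (every element of every interval has a complement in that interval; equivalently, whenever $a\leq b$ there is $c\geq a$ with $b\sqcap c=a$ and $b\sqcup c=1$). A lattice $\langle L,\sqcap,\sqcup,1\rangle$ is dual disjunctive if it is distributive, has top element $1$, and for all $a,b\in L$ with $a>b$ there is $c\in L$ such that $a\sqcup c=1>b\sqcup c$. $[a,1]=\{x\in L: a\leq x\leq 1\}$. -}

module Defs where

open import Level using (suc; _⊔_)
open import Data.Product.Base using (∃-syntax; _×_)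
open import Relation.Binary.Definitions using (Maximum)
open import Relation.Binary.Lattice.Bundles using (DistributiveLattice)
open import Relation.Unary using (Pred; _∈_)
import Relation.Binary.Properties.Poset as PosetProperties

record DistributiveLatticeWithTop c ℓ₁ ℓ₂ : Set (suc (c ⊔ ℓ₁ ⊔ ℓ₂)) where
  field
    distributiveLattice : DistributiveLattice c ℓ₁ ℓ₂

  open DistributiveLattice distributiveLattice public

  field
    𝟏         : Carrier
    𝟏-maximum : Maximum _≤_ 𝟏

  open PosetProperties poset public using (_<_)

  [_,_] : Carrier → Carrier → Pred Carrier ℓ₂
  [ a , b ] x = a ≤ x × x ≤ b

  IsMin : ∀ {ℓ} → Pred Carrier ℓ → Carrier → Set (c ⊔ ℓ₂ ⊔ ℓ)
  IsMin P m = m ∈ P × (∀ x → x ∈ P → m ≤ x)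

module _ {c ℓ₁ ℓ₂} (L : DistributiveLatticeWithTop c ℓ₁ ℓ₂) where
  open DistributiveLatticeWithTop L

  RelativelyComplemented : Set (c ⊔ ℓ₁ ⊔ ℓ₂)
  RelativelyComplemented =
    ∀ a b x → x ∈ [ a , b ] →
    ∃[ y ] (y ∈ [ a , b ] × x ∧ y ≈ a × x ∨ y ≈ b)

  -- Distributivity and the top element, which are part of the next two
  -- notions, are already supplied by L.
  ClassicalImplicative : Set (c ⊔ ℓ₁ ⊔ ℓ₂)
  ClassicalImplicative = RelativelyComplemented

  DualDisjunctive : Set (c ⊔ ℓ₁ ⊔ ℓ₂)
  DualDisjunctive =
    ∀ a b → b < a → ∃[ d ] (a ∨ d ≈ 𝟏 × b ∨ d < 𝟏)

{-# OPTIONS --safe #-}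

-- A complement of b in [a,1] is the least x ∈ [a,1] with b ∨ x = 1.
-- Conversely the least such b* is a complement: if a < b ∧ b*, then dual
-- disjunctivity gives d with (b ∧ b*) ∨ d = 1 > a ∨ d, but b ∨ d = 1 forces
-- b* ≤ a ∨ d, whence 1 = b* ∨ d ≤ a ∨ d.  Complements in [a,b] are
-- obtained from those in [a,1] by meeting with b.

module Submission where

open import Axiom.ExcludedMiddle using (ExcludedMiddle)
open import Data.Product.Base using (∃-syntax; _×_; _,_)
open import Function.Base using (_∘_)
open import Function.Bundles using (_⇔_; mk⇔)
open import Relation.Nullary.Decidable using (decidable-stable)
open import Relation.Nullary.Negation using (¬_)
open import Relation.Unary using (_∈_)
import Relation.Binary.Lattice.Properties.DistributiveLattice as DistributiveLatticeProperties
import Relation.Binary.Lattice.Properties.JoinSemilattice as JoinSemilatticeProperties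
import Relation.Binary.Lattice.Properties.MeetSemilattice as MeetSemilatticeProperties
import Relation.Binary.Properties.Poset as PosetProperties
import Relation.Binary.Reasoning.PartialOrder as PartialOrderReasoning
open import Defs

module _ {c ℓ₁ ℓ₂} (L : DistributiveLatticeWithTop c ℓ₁ ℓ₂) where
  open DistributiveLatticeWithTop L
  open DistributiveLatticeProperties distributiveLattice using (∨-distribˡ-∧)
  open JoinSemilatticeProperties joinSemilattice using (∨-monotonic; x≤y⇒x∨y≈y)
  open MeetSemilatticeProperties meetSemilattice using (∧-monotonic; ∧-cong; ∧-comm)
  open PosetProperties poset using (<⇒≱; ≤∧≉⇒<)
  open PartialOrderReasoning poset

  IsDualPseudocomplement : Carrier → Carrier → Carrier → Set _
  IsDualPseudocomplement a b = IsMin (λ x → x ∈ [ a , 𝟏 ] × b ∨ x ≈ 𝟏)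

  DualPseudocomplemented : Set _
  DualPseudocomplemented = ∀ a b → b ∈ [ a , 𝟏 ] → ∃[ b* ] IsDualPseudocomplement a b b*

  𝟏≤⇒≈𝟏 : ∀ {x} → 𝟏 ≤ x → x ≈ 𝟏
  𝟏≤⇒≈𝟏 = antisym (𝟏-maximum _)

  ∨≈𝟏-monotonic : ∀ {x y u v} → x ≤ y → u ≤ v → x ∨ u ≈ 𝟏 → y ∨ v ≈ 𝟏
  ∨≈𝟏-monotonic x≤y u≤v x∨u≈𝟏 =
    𝟏≤⇒≈𝟏 (trans (reflexive (Eq.sym x∨u≈𝟏)) (∨-monotonic x≤y u≤v))

  -- Minimality is distributivity: for a competitor `x`, joining with `b` to the top splits `y` into
  -- `y ∧ b`, which is `a` and hence below `x`, and `y ∧ x`.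
  complement⇒dualPseudocomplement : ∀ {a b y} → y ∈ [ a , 𝟏 ] →
    b ∧ y ≈ a → b ∨ y ≈ 𝟏 → IsDualPseudocomplement a b y
  complement⇒dualPseudocomplement {a} {b} {y} y∈ b∧y≈a b∨y≈𝟏 =
    (y∈ , b∨y≈𝟏) , λ { x ((a≤x , _) , b∨x≈𝟏) → begin
      y                  ≤⟨ ∧-greatest refl (𝟏-maximum y) ⟩
      y ∧ 𝟏              ≈⟨ ∧-cong Eq.refl b∨x≈𝟏 ⟨
      y ∧ (b ∨ x)        ≈⟨ ∧-distribˡ-∨ y b x ⟩
      (y ∧ b) ∨ (y ∧ x)  ≤⟨ ∨-monotonic (reflexive (Eq.trans (∧-comm y b) b∧y≈a)) (x∧y≤y y x) ⟩
      a ∨ x              ≤⟨ ∨-least a≤x refl ⟩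
      x                  ∎ }

  relativelyComplemented⇒dualPseudocomplemented :
    RelativelyComplemented L → DualPseudocomplemented
  relativelyComplemented⇒dualPseudocomplemented rc a b b∈ =
    let y , y∈ , b∧y≈a , b∨y≈𝟏 = rc a 𝟏 b b∈
    in y , complement⇒dualPseudocomplement y∈ b∧y≈a b∨y≈𝟏

  -- The separating element is the complement `d` of `a` in `[ b , 𝟏 ]`. Since `b ≤ d`, the join
  -- `b ∨ d` is just `d`; were it the top, `a` would equal `a ∧ d`, that is `b`.
  relativelyComplemented⇒dualDisjunctive : RelativelyComplemented L → DualDisjunctive L
  relativelyComplemented⇒dualDisjunctive rc a b b<a@(b≤a , _) =
    let d , (b≤d , _) , a∧d≈b , a∨d≈𝟏 = rc b 𝟏 a (b≤a , 𝟏-maximum a)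
        b∨d≉𝟏 : ¬ (b ∨ d ≈ 𝟏)
        b∨d≉𝟏 b∨d≈𝟏 = <⇒≱ b<a (begin
          a      ≤⟨ ∧-greatest refl (𝟏-maximum a) ⟩
          a ∧ 𝟏  ≈⟨ ∧-cong Eq.refl (Eq.trans (Eq.sym (x≤y⇒x∨y≈y b≤d)) b∨d≈𝟏) ⟨
          a ∧ d  ≈⟨ a∧d≈b ⟩
          b      ∎)
    in d , a∨d≈𝟏 , ≤∧≉⇒< (𝟏-maximum _) b∨d≉𝟏

  dualPseudocomplement-disjoint : ExcludedMiddle ℓ₁ → DualDisjunctive L →
    ∀ {a b b*} → a ≤ b → IsDualPseudocomplement a b b* → b ∧ b* ≈ a
  dualPseudocomplement-disjoint em dd {a} {b} {b*} a≤b (((a≤b* , _) , _) , least) =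
    -- Excluded middle makes `≈` stable under double negation. As `a` is always below `b ∧ b*`,
    -- failure of equality means strict inequality, which is what dual disjunctivity needs.
    decidable-stable em λ b∧b*≉a →
      let d , [b∧b*]∨d≈𝟏 , a∨d<𝟏 = dd (b ∧ b*) a (≤∧≉⇒< (∧-greatest a≤b a≤b*) (b∧b*≉a ∘ Eq.sym))
          -- Nothing places `d` above `a`, so the element compared with `b*` is `a ∨ d`, which does
          -- lie in `[ a , 𝟏 ]`.
          b∨[a∨d]≈𝟏 = ∨≈𝟏-monotonic (x∧y≤x b b*) (y≤x∨y a d) [b∧b*]∨d≈𝟏
          b*≤a∨d    = least (a ∨ d) ((x≤x∨y a d , 𝟏-maximum _) , b∨[a∨d]≈𝟏)
      in <⇒≱ a∨d<𝟏 (begin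
        𝟏             ≈⟨ [b∧b*]∨d≈𝟏 ⟨
        (b ∧ b*) ∨ d  ≤⟨ ∨-least (trans (x∧y≤y b b*) b*≤a∨d) (y≤x∨y a d) ⟩
        a ∨ d         ∎)

  -- Cutting `x*` down to `x* ∧ b` keeps it above `a`, so its meet with `x` is still `a`; by the
  -- dual distributive law its join with `x` is `(x ∨ x*) ∧ (x ∨ b)`, where the first factor is the
  -- top and the second is `b` because `x ≤ b`.
  dualPseudocomplemented⇒relativelyComplemented : ExcludedMiddle ℓ₁ →
    DualDisjunctive L → DualPseudocomplemented → RelativelyComplemented L
  dualPseudocomplemented⇒relativelyComplemented em dd dp a b x (a≤x , x≤b)
    with dp a x (a≤x , 𝟏-maximum x)
  ... | x* , x*-min@(((a≤x* , _) , x∨x*≈𝟏) , _) =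
    x* ∧ b , (a≤x*∧b , x∧y≤y x* b) , antisym x∧[x*∧b]≤a (∧-greatest a≤x a≤x*∧b) ,
    antisym (∨-least x≤b (x∧y≤y x* b)) b≤x∨[x*∧b]
    where
    a≤x*∧b = ∧-greatest a≤x* (trans a≤x x≤b)

    x∧[x*∧b]≤a : x ∧ (x* ∧ b) ≤ a
    x∧[x*∧b]≤a = begin
      x ∧ (x* ∧ b)  ≤⟨ ∧-monotonic refl (x∧y≤x x* b) ⟩
      x ∧ x*        ≈⟨ dualPseudocomplement-disjoint em dd a≤x x*-min ⟩
      a             ∎

    b≤x∨[x*∧b] : b ≤ x ∨ (x* ∧ b)
    b≤x∨[x*∧b] = begin
      b                    ≤⟨ ∧-greatest (𝟏-maximum b) (y≤x∨y x b) ⟩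
      𝟏 ∧ (x ∨ b)          ≈⟨ ∧-cong x∨x*≈𝟏 Eq.refl ⟨
      (x ∨ x*) ∧ (x ∨ b)   ≈⟨ ∨-distribˡ-∧ x x* b ⟨
      x ∨ (x* ∧ b)         ∎

corollary5p3p4 : ∀ {c ℓ₁ ℓ₂} → ExcludedMiddle ℓ₁ →
    (L : DistributiveLatticeWithTop c ℓ₁ ℓ₂) →
    let open DistributiveLatticeWithTop L in
    ClassicalImplicative L ⇔
    (DualDisjunctive L ×
    (∀ a b → b ∈ [ a , 𝟏 ] →
    ∃[ b* ] IsMin (λ x → x ∈ [ a , 𝟏 ] × b ∨ x ≈ 𝟏) b*))
corollary5p3p4 em L = mk⇔
  (λ rc → relativelyComplemented⇒dualDisjunctive L rc ,
          relativelyComplemented⇒dualPseudocomplemented L rc)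
  (λ (dd , dp) → dualPseudocomplemented⇒relativelyComplemented L em dd dp)
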